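{- Let $d \ge 1$ and $j$ be integers with $d/2 < j \le d$. Then the smallest eigenvalue of $J(2d,d,j)$, and the second largest in absolute value, is $E_j(1)$; that is, $E_j(1)\le E_j(i)$ for all $0\le i\le d$ and $|E_j(i)|\le |E_j(1)|$ for all $1\le i\le d$.
   Context: $J(2d,d,j)$ is the graph whose vertices are the $d$-subsets of a fixed $2d$-set, two vertices being adjacent when they meet in exactly $d-j$ elements. Its eigenvalues are the numbers (with $n=2d$) $$E_j(i) = \sum_{h=0}^j (-1)^h \binom{i}{h} \binom{d-i}{j-h} \binom{n-d-i}{j-h},\qquad 0\le i\le d,$$ and $E_j(0)$ is the valency. -}

module Defs where

open import Data.Nat.Base using (ℕ; suc; _∸_)
import Data.Nat.Base as ℕ
open import Data.Nat.Combinatorics using (_C_)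
open import Data.Integer.Base using (ℤ; +_; -1ℤ; 0ℤ; _+_; _*_; _^_)
open import Data.List.Base using (foldr; map; upTo)

-- ∑[ h ≤ m ] f h ranges over 0 ≤ h ≤ m, both ends included.
sum≤ : ℕ → (ℕ → ℤ) → ℤ
sum≤ m f = foldr _+_ 0ℤ (map f (upTo (suc m)))

syntax sum≤ m (λ h → t) = ∑[ h ≤ m ] t

-- The eigenvalues E_j(i), 0 ≤ i ≤ d, of J(n,d,j), whose vertices are the
-- d-subsets of an n-set, adjacent when they meet in exactly d - j elements.
-- For i ≤ d and d + i ≤ n every truncated subtraction below is exact, and
-- a C b = 0 whenever b > a.
E : (n d j i : ℕ) → ℤ
E n d j i =
  ∑[ h ≤ j ] (-1ℤ ^ h * + ((i C h) ℕ.* ((d ∸ i) C (j ∸ h)) ℕ.* ((n ∸ d ∸ i) C (j ∸ h))))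

{-# OPTIONS --safe #-}
-- E_j(i) is the coefficient of (xy)^j in (1 - xy)^i ((1 + x)(1 + y))^k with
-- k = d - i, so for fixed k it satisfies the Pascal-type recurrence
-- e(i+1, j+1) = e(i, j+1) - e(i, j).  For i = 1 one computes
-- d |E_j(1)| = |2j - d| (d C j)², and the triangle inequality in the recurrence
-- propagates d |E_j(i)| ≤ (2j - d) (d C j)² to all i ≥ 1, as long as 2j > d.
-- Near the middle layer this bound is not self-supporting, so the induction also
-- carries 2 (d - 1) |E_j(i)| ≤ (d C j)² for 2j = d, where reflecting j to d - j
-- makes the two terms of the recurrence equal in absolute value.
module Submission where

open import Data.Nat.Base
  using (ℕ; zero; suc; pred; _+_; _∸_; _≤_; _<_; _*_; z≤n; s≤s; NonZero; >-nonZero)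
open import Data.Nat.Properties
open import Data.Nat.Combinatorics
  using (_C_; nCk≡nC[n∸k]; nC1≡n; nCn≡1; k>n⇒nCk≡0; nCk+nC[k+1]≡[n+1]C[k+1])
import Data.Nat.Tactic.RingSolver as ℕ-Solver
open import Data.Integer.Base
  using (ℤ; +_; -[1+_]; -1ℤ; 0ℤ; 1ℤ; ∣_∣; _⊖_; _^_; -≤-; -≤+; +≤+)
  renaming (_≤_ to _≤ℤ_; _+_ to _+ℤ_; _-_ to _-ℤ_; _*_ to _*ℤ_; -_ to -ℤ_)
import Data.Integer.Properties as ℤ
import Data.Integer.Tactic.RingSolver as ℤ-Solver
open import Data.List.Base using (foldr)
open import Data.List.Properties using (map-applyUpTo)
open import Data.Product.Base using (_×_; _,_; proj₁)
open import Function.Base using (_∘_; id)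
open import Relation.Binary.PropositionalEquality
  using (_≡_; refl; sym; trans; cong; cong₂; subst; module ≡-Reasoning)
open import Defs

-- The alternating sum and its Pascal recurrence.

-- eigen k i j is E_j(i) for d = k + i.
eigen : (k i j : ℕ) → ℤ
eigen k zero    j       = + ((k C j) * (k C j))
eigen k (suc i) zero    = eigen k i zero
eigen k (suc i) (suc j) = eigen k i (suc j) -ℤ eigen k i j

sum≤-suc : ∀ m f → sum≤ (suc m) f ≡ f 0 +ℤ sum≤ m (f ∘ suc)
sum≤-suc m f = cong (λ xs → f 0 +ℤ foldr _+ℤ_ 0ℤ xs)
  (trans (map-applyUpTo suc f (suc m)) (sym (map-applyUpTo id (f ∘ suc) (suc m))))

sum≤-difference : ∀ m (f g h : ℕ → ℤ) → (∀ n → f n ≡ g n -ℤ h n) →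
                  sum≤ m f ≡ sum≤ m g -ℤ sum≤ m h
sum≤-difference zero f g h eq = begin
  f 0 +ℤ 0ℤ                  ≡⟨ cong (_+ℤ 0ℤ) (eq 0) ⟩
  (g 0 -ℤ h 0) +ℤ 0ℤ         ≡⟨ rearrange (g 0) (h 0) ⟩
  (g 0 +ℤ 0ℤ) -ℤ (h 0 +ℤ 0ℤ) ∎
  where
  open ≡-Reasoning
  rearrange : ∀ x y → (x -ℤ y) +ℤ 0ℤ ≡ (x +ℤ 0ℤ) -ℤ (y +ℤ 0ℤ)
  rearrange = ℤ-Solver.solve-∀
sum≤-difference (suc m) f g h eq
  rewrite sum≤-suc m f | sum≤-suc m g | sum≤-suc m h
        | sum≤-difference m (f ∘ suc) (g ∘ suc) (h ∘ suc) (eq ∘ suc) | eq 0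
  = rearrange (g 0) (h 0) _ _
  where
  rearrange : ∀ x y s t → (x -ℤ y) +ℤ (s -ℤ t) ≡ (x +ℤ s) -ℤ (y +ℤ t)
  rearrange = ℤ-Solver.solve-∀

sum≤-zero : ∀ m {f : ℕ → ℤ} → (∀ n → f n ≡ 0ℤ) → sum≤ m f ≡ 0ℤ
sum≤-zero zero    eq = trans (ℤ.+-identityʳ _) (eq 0)
sum≤-zero (suc m) {f} eq rewrite sum≤-suc m f | sum≤-zero m (eq ∘ suc) | eq 0 = refl

-- For `n = 2d` both `d - i` and `n - d - i` equal `k`, so the summand of `E` contains a square.
-- With `k` as a parameter, `i` occurs only in `i C h`.
term : (k i j h : ℕ) → ℤ
term k i j h = -1ℤ ^ h *ℤ + ((i C h) * (k C (j ∸ h)) * (k C (j ∸ h)))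

-- Pascal's rule splits `suc i C suc h`. The part with `i C h` is the summand shifted in both `h`
-- and `j`, which keeps `j ∸ h` and changes the sign.
term-pascal : ∀ k i j h →
  term k (suc i) (suc j) (suc h) ≡ term k i (suc j) (suc h) -ℤ term k i j h
term-pascal k i j h = begin
  -1ℤ *ℤ s *ℤ + ((suc i C suc h) * x * x)
    ≡⟨ cong (λ z → -1ℤ *ℤ s *ℤ + (z * x * x)) (nCk+nC[k+1]≡[n+1]C[k+1] i h) ⟨
  -1ℤ *ℤ s *ℤ + ((u + v) * x * x)
    ≡⟨ cong (λ z → -1ℤ *ℤ s *ℤ + z) (expand u v x) ⟩
  -1ℤ *ℤ s *ℤ (+ (u * x * x) +ℤ + (v * x * x))
    ≡⟨ rearrange s (+ (u * x * x)) (+ (v * x * x)) ⟩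
  -1ℤ *ℤ s *ℤ + (v * x * x) -ℤ s *ℤ + (u * x * x) ∎
  where
  open ≡-Reasoning
  s = -1ℤ ^ h
  u = i C h
  v = i C suc h
  x = k C (j ∸ h)
  expand : ∀ u v x → (u + v) * x * x ≡ u * x * x + v * x * x
  expand = ℕ-Solver.solve-∀
  rearrange : ∀ s a b → -1ℤ *ℤ s *ℤ (a +ℤ b) ≡ -1ℤ *ℤ s *ℤ b -ℤ s *ℤ a
  rearrange = ℤ-Solver.solve-∀

sum-term≡eigen : ∀ k i j → sum≤ j (term k i j) ≡ eigen k i j
sum-term≡eigen k zero zero = refl
sum-term≡eigen k zero (suc j) = begin
  sum≤ (suc j) (term k 0 (suc j))
    ≡⟨ sum≤-suc j (term k 0 (suc j)) ⟩
  1ℤ *ℤ + (1 * x * x) +ℤ sum≤ j (term k 0 (suc j) ∘ suc)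
    ≡⟨ cong (1ℤ *ℤ + (1 * x * x) +ℤ_) (sum≤-zero j λ h → ℤ.*-zeroʳ (-1ℤ ^ suc h)) ⟩
  1ℤ *ℤ + (1 * x * x) +ℤ 0ℤ
    ≡⟨ trans (ℤ.+-identityʳ _) (ℤ.*-identityˡ _) ⟩
  + (1 * x * x)
    ≡⟨ cong (λ z → + (z * x)) (*-identityˡ x) ⟩
  + (x * x) ∎
  where
  open ≡-Reasoning
  x = k C suc j
sum-term≡eigen k (suc i) zero    = sum-term≡eigen k i zero
sum-term≡eigen k (suc i) (suc j) = begin
  sum≤ (suc j) (term k (suc i) (suc j))
    ≡⟨ sum≤-suc j (term k (suc i) (suc j)) ⟩
  t₀ +ℤ sum≤ j (term k (suc i) (suc j) ∘ suc)
    ≡⟨ cong (t₀ +ℤ_) (sum≤-difference j _ (term k i (suc j) ∘ suc) (term k i j) (term-pascal k i j)) ⟩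
  t₀ +ℤ (sum≤ j (term k i (suc j) ∘ suc) -ℤ sum≤ j (term k i j))
    ≡⟨ ℤ.+-assoc t₀ _ _ ⟨
  (t₀ +ℤ sum≤ j (term k i (suc j) ∘ suc)) -ℤ sum≤ j (term k i j)
    -- `t₀` is also the `h = 0` summand for `i`, since `suc i C 0` and `i C 0` are both 1.
    ≡⟨ cong (_-ℤ sum≤ j (term k i j)) (sum≤-suc j (term k i (suc j))) ⟨
  sum≤ (suc j) (term k i (suc j)) -ℤ sum≤ j (term k i j)
    ≡⟨ cong₂ _-ℤ_ (sum-term≡eigen k i (suc j)) (sum-term≡eigen k i j) ⟩
  eigen k i (suc j) -ℤ eigen k i j ∎
  where
  open ≡-Reasoning
  t₀ = term k (suc i) (suc j) 0

E≡eigen : ∀ d j i → E (2 * d) d j i ≡ eigen (d ∸ i) i j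
E≡eigen d j i
  rewrite trans (cong (λ n → d + n ∸ d) (+-identityʳ d)) (m+n∸m≡n d d)
  = sum-term≡eigen (d ∸ i) i j

-- Symmetry of the coefficients under reflection of `j`.

eigen-zero : ∀ k i → eigen k i 0 ≡ 1ℤ
eigen-zero k zero    = refl
eigen-zero k (suc i) = eigen-zero k i

-- The generating polynomial has degree `k + i` in each variable.
eigen-vanishes : ∀ k i {j} → k + i < j → eigen k i j ≡ 0ℤ
eigen-vanishes k zero {j} k+0<j rewrite k>n⇒nCk≡0 (subst (_< j) (+-identityʳ k) k+0<j) = refl
eigen-vanishes k (suc i) {suc j} lt
  rewrite +-suc k i
        | eigen-vanishes k i (m<n⇒m<1+n (≤-pred lt))
        | eigen-vanishes k i (≤-pred lt) = refl

C-mirror : ∀ a b → (a + b) C a ≡ (a + b) C b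
C-mirror a b = begin
  (a + b) C a           ≡⟨ nCk≡nC[n∸k] (m≤m+n a b) ⟩
  (a + b) C (a + b ∸ a) ≡⟨ cong ((a + b) C_) (m+n∸m≡n a b) ⟩
  (a + b) C b           ∎
  where open ≡-Reasoning

-- Inverting `x` and `y` and multiplying by `(xy)^(k + i)` preserves the factor `((1 + x)(1 + y))^k`
-- and turns `(1 - xy)^i` into `(-1)^i (1 - xy)^i`.
eigen-mirror : ∀ k i {a b} → a + b ≡ k + i → eigen k i a ≡ -1ℤ ^ i *ℤ eigen k i b
eigen-mirror k zero {a} {b} eq rewrite sym (trans eq (+-identityʳ k)) | C-mirror a b =
  sym (ℤ.*-identityˡ _)
eigen-mirror k (suc i) {zero}  {zero}  eq rewrite +-suc k i with () ← eq
eigen-mirror k (suc i) {zero}  {suc b} eq = begin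
  eigen k i 0
    ≡⟨ eigen-mirror k i b≡k+i ⟩
  s *ℤ eigen k i b
    ≡⟨ rearrange s (eigen k i b) ⟩
  -1ℤ *ℤ s *ℤ (0ℤ -ℤ eigen k i b)
    -- At index 0 the recurrence has a single term; on the mirrored side the coefficient beyond the
    -- degree supplies the matching zero.
    ≡⟨ cong (λ z → -1ℤ *ℤ s *ℤ (z -ℤ eigen k i b)) (eigen-vanishes k i k+i<1+b) ⟨
  -1ℤ *ℤ s *ℤ (eigen k i (suc b) -ℤ eigen k i b) ∎
  where
  open ≡-Reasoning
  s = -1ℤ ^ i
  b≡k+i : b ≡ k + i
  b≡k+i = suc-injective (trans eq (+-suc k i))
  k+i<1+b : k + i < suc b
  k+i<1+b = s≤s (≤-reflexive (sym b≡k+i))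
  rearrange : ∀ s x → s *ℤ x ≡ -1ℤ *ℤ s *ℤ (0ℤ -ℤ x)
  rearrange = ℤ-Solver.solve-∀
eigen-mirror k (suc i) {suc a} {zero}  eq = begin
  eigen k i (suc a) -ℤ eigen k i a
    ≡⟨ cong (_-ℤ eigen k i a) (eigen-vanishes k i k+i<1+a) ⟩
  0ℤ -ℤ eigen k i a
    ≡⟨ cong (_-ℤ_ 0ℤ) (eigen-mirror k i a+0≡k+i) ⟩
  0ℤ -ℤ s *ℤ eigen k i 0
    ≡⟨ rearrange s (eigen k i 0) ⟩
  -1ℤ *ℤ s *ℤ eigen k i 0 ∎
  where
  open ≡-Reasoning
  s = -1ℤ ^ i
  a+0≡k+i : a + 0 ≡ k + i
  a+0≡k+i = suc-injective (trans eq (+-suc k i))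
  k+i<1+a : k + i < suc a
  k+i<1+a = s≤s (≤-reflexive (trans (sym a+0≡k+i) (+-identityʳ a)))
  rearrange : ∀ s x → 0ℤ -ℤ s *ℤ x ≡ -1ℤ *ℤ s *ℤ x
  rearrange = ℤ-Solver.solve-∀
eigen-mirror k (suc i) {suc a} {suc b} eq = begin
  eigen k i (suc a) -ℤ eigen k i a
    ≡⟨ cong₂ _-ℤ_ (eigen-mirror k i 1+a+b≡k+i) (eigen-mirror k i a+1+b≡k+i) ⟩
  s *ℤ eigen k i b -ℤ s *ℤ eigen k i (suc b)
    ≡⟨ rearrange s (eigen k i b) (eigen k i (suc b)) ⟩
  -1ℤ *ℤ s *ℤ (eigen k i (suc b) -ℤ eigen k i b) ∎
  where
  open ≡-Reasoning
  s = -1ℤ ^ i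
  a+1+b≡k+i : a + suc b ≡ k + i
  a+1+b≡k+i = suc-injective (trans eq (+-suc k i))
  1+a+b≡k+i : suc a + b ≡ k + i
  1+a+b≡k+i = trans (sym (+-suc a b)) a+1+b≡k+i
  rearrange : ∀ s x y → s *ℤ x -ℤ s *ℤ y ≡ -1ℤ *ℤ s *ℤ (y -ℤ x)
  rearrange = ℤ-Solver.solve-∀

∣-1^i*x∣≡∣x∣ : ∀ i x → ∣ -1ℤ ^ i *ℤ x ∣ ≡ ∣ x ∣
∣-1^i*x∣≡∣x∣ zero    x = cong ∣_∣ (ℤ.*-identityˡ x)
∣-1^i*x∣≡∣x∣ (suc i) x = begin
  ∣ -1ℤ *ℤ -1ℤ ^ i *ℤ x ∣   ≡⟨ cong ∣_∣ (ℤ.*-assoc -1ℤ (-1ℤ ^ i) x) ⟩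
  ∣ -1ℤ *ℤ (-1ℤ ^ i *ℤ x) ∣ ≡⟨ cong ∣_∣ (ℤ.-1*i≡-i (-1ℤ ^ i *ℤ x)) ⟩
  ∣ -ℤ (-1ℤ ^ i *ℤ x) ∣     ≡⟨ ℤ.∣-i∣≡∣i∣ (-1ℤ ^ i *ℤ x) ⟩
  ∣ -1ℤ ^ i *ℤ x ∣          ≡⟨ ∣-1^i*x∣≡∣x∣ i x ⟩
  ∣ x ∣                     ∎
  where open ≡-Reasoning

∣eigen∣-mirror : ∀ k i {a b} → a + b ≡ k + i → ∣ eigen k i a ∣ ≡ ∣ eigen k i b ∣
∣eigen∣-mirror k i {a} {b} eq =
  trans (cong ∣_∣ (eigen-mirror k i eq)) (∣-1^i*x∣≡∣x∣ i (eigen k i b))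

-- Absorption identities for binomial coefficients.

C-absorb : ∀ n k → suc n * (n C k) ≡ suc k * (suc n C suc k)
C-absorb zero    zero    = refl
C-absorb zero    (suc k) = sym (*-zeroʳ k)
C-absorb (suc n) zero    = trans (*-identityʳ _) (sym (trans (*-identityˡ _) (nC1≡n (suc (suc n)))))
C-absorb (suc n) (suc k) = begin
  suc (suc n) * (suc n C suc k)
    ≡⟨⟩
  x + suc n * (suc n C suc k)
    ≡⟨ cong (λ z → x + suc n * z) (nCk+nC[k+1]≡[n+1]C[k+1] n k) ⟨
  x + suc n * (n C k + (n C suc k))
    ≡⟨ cong (_+_ x) (*-distribˡ-+ (suc n) (n C k) (n C suc k)) ⟩
  x + (suc n * (n C k) + suc n * (n C suc k))
    ≡⟨ cong (_+_ x) (cong₂ _+_ (C-absorb n k) (C-absorb n (suc k))) ⟩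
  x + (suc k * x + suc (suc k) * y)
    ≡⟨ +-assoc x (suc k * x) (suc (suc k) * y) ⟨
  suc (suc k) * x + suc (suc k) * y
    ≡⟨ *-distribˡ-+ (suc (suc k)) x y ⟨
  suc (suc k) * (x + y)
    ≡⟨ cong (suc (suc k) *_) (nCk+nC[k+1]≡[n+1]C[k+1] (suc n) (suc k)) ⟩
  suc (suc k) * (suc (suc n) C suc (suc k)) ∎
  where
  open ≡-Reasoning
  x = suc n C suc k
  y = suc n C suc (suc k)

-- Pascal's rule multiplied by `suc (a + b)`, minus the absorption identity.
C-coabsorb : ∀ a b → suc (a + b) * ((a + b) C suc a) ≡ b * (suc (a + b) C suc a)
C-coabsorb a b = +-cancelˡ-≡ (suc a * D) _ _ (begin
  suc a * D + suc (a + b) * e           ≡⟨ cong (_+ suc (a + b) * e) (C-absorb (a + b) a) ⟨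
  suc (a + b) * c + suc (a + b) * e     ≡⟨ *-distribˡ-+ (suc (a + b)) c e ⟨
  suc (a + b) * (c + e)                 ≡⟨ cong (suc (a + b) *_) (nCk+nC[k+1]≡[n+1]C[k+1] (a + b) a) ⟩
  (suc a + b) * D                       ≡⟨ *-distribʳ-+ D (suc a) b ⟩
  suc a * D + b * D                     ∎)
  where
  open ≡-Reasoning
  c = (a + b) C a
  e = (a + b) C suc a
  D = suc (a + b) C suc a

-- Weighted inequalities behind the induction steps.

-- Put `p = b + m + 2`, `q = b + 1`, `d = p + q`. As `p - q = m + 1`, one has `(m + 1) d = p² - q²`,
-- and both sides equal `(m + 1) d² - (p² - q²)`.
weights : ∀ b m →
  (2 + m) * (suc b * suc b) + m * (suc (b + suc m) * suc (b + suc m))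
    + 2 * (suc m * (suc (b + suc m) * suc b))
  ≡ (b + suc m + suc b) * (suc m * suc (b + suc m + suc b))
weights = ℕ-Solver.solve-∀

square-scaling : ∀ c d p D → d * c ≡ p * D → d * (d * (c * c)) ≡ p * (p * (D * D))
square-scaling c d p D eq = begin
  d * (d * (c * c))   ≡⟨ squares d c ⟩
  (d * c) * (d * c)   ≡⟨ cong₂ _*_ eq eq ⟩
  (p * D) * (p * D)   ≡⟨ squares p D ⟨
  p * (p * (D * D))   ∎
  where
  open ≡-Reasoning
  squares : ∀ x y → x * (x * (y * y)) ≡ (x * y) * (x * y)
  squares = ℕ-Solver.solve-∀

-- Multiplying by d² expresses c and e through D, and the two weights then
-- fall short of n (m + 1) d by exactly 2 (m + 1) p q.
off-centre-step : ∀ b m {c e D g₁ g₂} →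
  let p = suc (b + suc m); q = suc b; d = p + q in
  d * c ≡ p * D → d * e ≡ q * D →
  pred d * g₁ ≤ (2 + m) * (e * e) → pred d * g₂ ≤ m * (c * c) →
  d * (g₁ + g₂) ≤ suc m * (D * D)
off-centre-step b m {c} {e} {D} {g₁} {g₂} dc≡pD de≡qD bound₁ bound₂ =
  *-cancelˡ-≤ d (*-cancelˡ-≤ n (begin
    n * (d * (d * (g₁ + g₂)))
      ≡⟨ collect n d g₁ g₂ ⟩
    d * (d * (n * g₁ + n * g₂))
      ≤⟨ *-monoʳ-≤ d (*-monoʳ-≤ d (+-mono-≤ bound₁ bound₂)) ⟩
    d * (d * ((2 + m) * (e * e) + m * (c * c)))
      ≡⟨ distribute d m (e * e) (c * c) ⟩
    (2 + m) * (d * (d * (e * e))) + m * (d * (d * (c * c)))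
      ≡⟨ cong₂ (λ x y → (2 + m) * x + m * y) (square-scaling e d q D de≡qD) (square-scaling c d p D dc≡pD) ⟩
    (2 + m) * (q * (q * (D * D))) + m * (p * (p * (D * D)))
      ≡⟨ factor m p q (D * D) ⟩
    ((2 + m) * (q * q) + m * (p * p)) * (D * D)
      ≤⟨ *-monoˡ-≤ (D * D) weights≤ ⟩
    n * (suc m * d) * (D * D)
      ≡⟨ regroup n d m (D * D) ⟩
    n * (d * (suc m * (D * D))) ∎))
  where
  open ≤-Reasoning
  p = suc (b + suc m)
  q = suc b
  n = b + suc m + suc b
  d = p + q
  instance
    n≢0 : NonZero n
    n≢0 = >-nonZero (≤-trans (s≤s z≤n) (m≤n+m (suc b) (b + suc m)))
  weights≤ : (2 + m) * (q * q) + m * (p * p) ≤ n * (suc m * d)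
  weights≤ = ≤-trans (m≤m+n _ (2 * (suc m * (p * q)))) (≤-reflexive (weights b m))
  collect : ∀ n d x y → n * (d * (d * (x + y))) ≡ d * (d * (n * x + n * y))
  collect = ℕ-Solver.solve-∀
  distribute : ∀ d m x y →
    d * (d * ((2 + m) * x + m * y)) ≡ (2 + m) * (d * (d * x)) + m * (d * (d * y))
  distribute = ℕ-Solver.solve-∀
  factor : ∀ m p q x →
    (2 + m) * (q * (q * x)) + m * (p * (p * x)) ≡ ((2 + m) * (q * q) + m * (p * p)) * x
  factor = ℕ-Solver.solve-∀
  regroup : ∀ n d m x → n * (suc m * d) * x ≡ n * (d * (suc m * x))
  regroup = ℕ-Solver.solve-∀

-- Carries a bound from row `d - 1` of Pascal's triangle to row `d`: the square of `c = (p / d) D`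
-- brings `p²`, of which one factor cancels.
scaled-bound : ∀ p .{{_ : NonZero p}} d c D g →
  d * c ≡ p * D → p * g ≤ c * c → d * (d * g) ≤ p * (D * D)
scaled-bound p d c D g dc≡pD pg≤cc = *-cancelˡ-≤ p (begin
  p * (d * (d * g))   ≡⟨ commute p d g ⟩
  d * (d * (p * g))   ≤⟨ *-monoʳ-≤ d (*-monoʳ-≤ d pg≤cc) ⟩
  d * (d * (c * c))   ≡⟨ square-scaling c d p D dc≡pD ⟩
  p * (p * (D * D))   ∎)
  where
  open ≤-Reasoning
  commute : ∀ p d g → p * (d * (d * g)) ≡ d * (d * (p * g))
  commute = ℕ-Solver.solve-∀

-- The case `2j - d = 1`. After scaling, the two terms contribute `q D²` and `p D²`, which add up to
-- exactly `d D²`.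
near-centre-step : ∀ b {c e D g₁ g₂} →
  let q = suc b; p = suc q; d = p + q in
  d * c ≡ p * D → d * e ≡ q * D →
  (q + q) * g₁ ≤ 2 * (e * e) → 2 * (pred (q + q) * g₂) ≤ c * c →
  d * (g₁ + g₂) ≤ D * D
near-centre-step b {c} {e} {D} {g₁} {g₂} dc≡pD de≡qD bound₁ bound₂ = *-cancelˡ-≤ d (begin
  d * (d * (g₁ + g₂))             ≡⟨ distribute d g₁ g₂ ⟩
  d * (d * g₁) + d * (d * g₂)     ≤⟨ +-mono-≤ (scaled-bound q d e D g₁ de≡qD qg₁≤ee) (scaled-bound p d c D g₂ dc≡pD pg₂≤cc) ⟩
  q * (D * D) + p * (D * D)       ≡⟨ factor p q (D * D) ⟩
  d * (D * D)                     ∎)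
  where
  open ≤-Reasoning
  q = suc b
  p = suc q
  d = p + q
  distribute : ∀ d x y → d * (d * (x + y)) ≡ d * (d * x) + d * (d * y)
  distribute = ℕ-Solver.solve-∀
  factor : ∀ p q x → q * x + p * x ≡ (p + q) * x
  factor = ℕ-Solver.solve-∀
  double : ∀ q x → 2 * (q * x) ≡ (q + q) * x
  double = ℕ-Solver.solve-∀
  split : ∀ b x → (2 + b) * x + 3 * (b * x) ≡ 2 * ((b + suc b) * x)
  split = ℕ-Solver.solve-∀
  qg₁≤ee : q * g₁ ≤ e * e
  qg₁≤ee = *-cancelˡ-≤ 2 (≤-trans (≤-reflexive (double q g₁)) bound₁)
  pg₂≤cc : p * g₂ ≤ c * c
  -- The central bound has slack `3b` here: `b + 2` is needed and `2 (2b + 1)` is available.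
  pg₂≤cc = ≤-trans (≤-trans (m≤m+n (p * g₂) (3 * (b * g₂))) (≤-reflexive (split b g₂))) bound₂

-- The eigenvalue at `i = 1`.

-- With `p = suc a`, absorption gives `d² (c² - e²) = (p² - b²) D²`, and `p² - b²` factors as
-- `(m + 1) d`. The subtraction is avoided by moving `e²` to the right.
C²-step : ∀ a b m → suc a ≡ b + suc m →
  let d = suc (a + b); c = (a + b) C a; e = (a + b) C suc a; D = d C suc a in
  d * (c * c) ≡ suc m * (D * D) + d * (e * e)
C²-step a b m 1+a≡b+1+m = *-cancelˡ-≡ _ _ d (begin
  d * (d * (c * c))
    ≡⟨ square-scaling c d (suc a) D (C-absorb (a + b) a) ⟩
  suc a * (suc a * (D * D))
    ≡⟨ cong (λ p → p * (p * (D * D))) 1+a≡b+1+m ⟩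
  (b + suc m) * ((b + suc m) * (D * D))
    ≡⟨ rearrange b m (D * D) ⟩
  (b + suc m + b) * (suc m * (D * D)) + b * (b * (D * D))
    ≡⟨ cong₂ (λ p x → (p + b) * (suc m * (D * D)) + x) (sym 1+a≡b+1+m)
             (sym (square-scaling e d b D (C-coabsorb a b))) ⟩
  d * (suc m * (D * D)) + d * (d * (e * e))
    ≡⟨ *-distribˡ-+ d (suc m * (D * D)) (d * (e * e)) ⟨
  d * (suc m * (D * D) + d * (e * e)) ∎)
  where
  open ≡-Reasoning
  d = suc (a + b)
  c = (a + b) C a
  e = (a + b) C suc a
  D = d C suc a
  rearrange : ∀ b m x → (b + suc m) * ((b + suc m) * x) ≡
                        (b + suc m + b) * (suc m * x) + b * (b * x)
  rearrange = ℕ-Solver.solve-∀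

C²-decreasing : ∀ a b m → suc a ≡ b + suc m →
  ((a + b) C suc a) * ((a + b) C suc a) ≤ ((a + b) C a) * ((a + b) C a)
C²-decreasing a b m eq = *-cancelˡ-≤ (suc (a + b))
  (≤-trans (m≤n+m _ (suc m * (D * D))) (≤-reflexive (sym (C²-step a b m eq))))
  where D = suc (a + b) C suc a

eigen₁-nonpositive : ∀ a b m → suc a ≡ b + suc m → eigen (a + b) 1 (suc a) ≤ℤ 0ℤ
eigen₁-nonpositive a b m eq = ℤ.i≤j⇒i-j≤0 (+≤+ (C²-decreasing a b m eq))

∣eigen₁∣ : ∀ a b m → suc a ≡ b + suc m →
  suc (a + b) * ∣ eigen (a + b) 1 (suc a) ∣ ≡
  suc m * ((suc (a + b) C suc a) * (suc (a + b) C suc a))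
∣eigen₁∣ a b m eq = begin
  d * ∣ + (e * e) -ℤ + (c * c) ∣        ≡⟨ cong (λ z → d * ∣ z ∣) (ℤ.m-n≡m⊖n (e * e) (c * c)) ⟩
  d * ∣ e * e ⊖ c * c ∣                 ≡⟨ cong (d *_) (ℤ.∣⊖∣-≤ (C²-decreasing a b m eq)) ⟩
  d * (c * c ∸ e * e)                   ≡⟨ *-distribˡ-∸ d (c * c) (e * e) ⟩
  d * (c * c) ∸ d * (e * e)             ≡⟨ cong (_∸ d * (e * e)) (C²-step a b m eq) ⟩
  suc m * (D * D) + d * (e * e) ∸ d * (e * e) ≡⟨ m+n∸n≡m (suc m * (D * D)) (d * (e * e)) ⟩
  suc m * (D * D) ∎
  where
  open ≡-Reasoning
  d = suc (a + b)
  c = (a + b) C a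
  e = (a + b) C suc a
  D = d C suc a

-- Simultaneous induction on `i` for fixed `k`.

C² : ℕ → ℕ → ℕ
C² n j = (n C j) * (n C j)

-- Here n is d, a is j and b is d - j, so that suc m is 2j - d.
OffCentreBound : (k i : ℕ) → Set
OffCentreBound k i = ∀ {n} a b m → n ≡ k + i → a + b ≡ n → a ≡ b + suc m →
  n * ∣ eigen k i a ∣ ≤ suc m * C² n a

-- Putting `2j - d = 0` into the off-centre bound would make the middle coefficient vanish; this
-- holds for `i = 1` but not in general, so the middle gets its own estimate.
CentreBound : (k i : ℕ) → Set
CentreBound k i = ∀ {n} a → n ≡ k + i → a + a ≡ n →
  2 * (pred n * ∣ eigen k i a ∣) ≤ C² n a

off-centre₁ : ∀ k → OffCentreBound k 1
off-centre₁ k zero    b m eq refl a≡b+1+m with () ← trans a≡b+1+m (+-suc b m)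
off-centre₁ k (suc a) b m eq refl a≡b+1+m
  rewrite sym (suc-injective (trans eq (+-comm k 1))) = ≤-reflexive (∣eigen₁∣ a b m a≡b+1+m)

eigen₁-centre : ∀ a → eigen (a + suc a) 1 (suc a) ≡ 0ℤ
eigen₁-centre a rewrite C-mirror a (suc a) = ℤ.+-inverseʳ (+ C² (a + suc a) (suc a))

centre₁ : ∀ k → CentreBound k 1
centre₁ k zero    eq refl = z≤n
centre₁ k (suc a) eq refl
  rewrite sym (suc-injective (trans eq (+-comm k 1))) | eigen₁-centre a
  = ≤-trans (≤-reflexive (cong (2 *_) (*-zeroʳ (a + suc a)))) z≤n

eigen-last : ∀ k i {m} → m ≡ k + i → ∣ eigen k i m ∣ ≡ 1
eigen-last k i {m} eq =
  trans (∣eigen∣-mirror k i (trans (+-identityʳ m) eq)) (cong ∣_∣ (eigen-zero k i))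

-- As `d` drops by one, the terms at `j` and `j - 1` have `2j - d` raised and lowered by one
-- respectively. Only for `2j - d = 1` does the second term reach the middle.
off-centre-suc : ∀ k i → OffCentreBound k i → CentreBound k i → OffCentreBound k (suc i)
-- For `j = d` the eigenvalue is `1` in absolute value and both sides equal `d`.
off-centre-suc k i off centre a zero m n≡ refl refl
  rewrite +-identityʳ m | eigen-last k (suc i) {suc m} n≡ | nCn≡1 (suc m) = ≤-refl
off-centre-suc k i off centre (suc a) (suc b) zero n≡ refl 1+a≡
  -- This forces `a = b + 1`, so that `a` is the middle index of row `n = 2a`.
  with refl ← trans (suc-injective 1+a≡) (+-comm b 1) = begin
  d * ∣ eigen k i (suc a) -ℤ eigen k i a ∣
    ≤⟨ *-monoʳ-≤ d (ℤ.∣i-j∣≤∣i∣+∣j∣ (eigen k i (suc a)) (eigen k i a)) ⟩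
  d * (∣ eigen k i (suc a) ∣ + ∣ eigen k i a ∣)
    ≤⟨ near-centre-step b {n C a} {n C suc a} (C-absorb n a) (C-coabsorb a (suc b))
         (off (suc a) b 1 n≡k+i (sym (+-suc a b)) (+-comm 2 b))
         (centre a n≡k+i refl) ⟩
  C² d (suc a)
    ≡⟨ *-identityˡ _ ⟨
  1 * C² d (suc a) ∎
  where
  open ≤-Reasoning
  n = a + suc b
  d = suc n
  n≡k+i : n ≡ k + i
  n≡k+i = suc-injective (trans n≡ (+-suc k i))
off-centre-suc k i off centre (suc a) (suc b) (suc m) n≡ refl refl = begin
  d * ∣ eigen k i (suc a) -ℤ eigen k i a ∣
    ≤⟨ *-monoʳ-≤ d (ℤ.∣i-j∣≤∣i∣+∣j∣ (eigen k i (suc a)) (eigen k i a)) ⟩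
  d * (∣ eigen k i (suc a) ∣ + ∣ eigen k i a ∣)
    ≤⟨ off-centre-step b (suc m) (C-absorb n a) (C-coabsorb a (suc b))
         (off (suc a) b (suc (suc m)) n≡k+i (sym (+-suc a b)) (sym (+-suc b (suc (suc m)))))
         (off a (suc b) m n≡k+i refl (+-suc b (suc m))) ⟩
  suc (suc m) * C² d (suc a) ∎
  where
  open ≤-Reasoning
  n = a + suc b
  d = suc n
  n≡k+i : n ≡ k + i
  n≡k+i = suc-injective (trans n≡ (+-suc k i))

-- Both terms of the recurrence lie next to the middle of an odd row, where the off-centre bound has
-- factor `2j - d = 1`.
centre-suc : ∀ k i → OffCentreBound k i → CentreBound k (suc i)
centre-suc k i off zero    n≡ refl = z≤n
centre-suc k i off (suc a) n≡ refl = begin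
  2 * (n * ∣ eigen k i (suc a) -ℤ eigen k i a ∣)
    ≤⟨ *-monoʳ-≤ 2 (*-monoʳ-≤ n (ℤ.∣i-j∣≤∣i∣+∣j∣ (eigen k i (suc a)) (eigen k i a))) ⟩
  2 * (n * (g + ∣ eigen k i a ∣))
    ≡⟨ cong (λ x → 2 * (n * (g + x))) (∣eigen∣-mirror k i n≡k+i) ⟩
  2 * (n * (g + g))
    ≡⟨ double n g ⟩
  4 * (n * g)
    ≤⟨ *-monoʳ-≤ 4 (off (suc a) a 0 n≡k+i (sym (+-suc a a)) (+-comm 1 a)) ⟩
  4 * (1 * C² n (suc a))
    -- The two middle entries of row `n` coincide, so `e + e` is the central entry of the next row.
    ≡⟨ square-double (n C suc a) ⟩
  (e + e) * (e + e)
    ≡⟨ cong (λ x → (x + e) * (x + e)) (C-mirror a (suc a)) ⟨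
  ((n C a) + e) * ((n C a) + e)
    ≡⟨ cong (λ x → x * x) (nCk+nC[k+1]≡[n+1]C[k+1] n a) ⟩
  C² (suc n) (suc a) ∎
  where
  open ≤-Reasoning
  n = a + suc a
  g = ∣ eigen k i (suc a) ∣
  e = n C suc a
  n≡k+i : n ≡ k + i
  n≡k+i = suc-injective (trans n≡ (+-suc k i))
  double : ∀ n g → 2 * (n * (g + g)) ≡ 4 * (n * g)
  double = ℕ-Solver.solve-∀
  square-double : ∀ e → 4 * (1 * (e * e)) ≡ (e + e) * (e + e)
  square-double = ℕ-Solver.solve-∀

-- The induction starts at `i = 1`, because the valency at `i = 0` violates the off-centre bound
-- whenever `d/2 < j < d`.
bounds : ∀ k i → OffCentreBound k (suc i) × CentreBound k (suc i)
bounds k zero    = off-centre₁ k , centre₁ k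
bounds k (suc i) with off , centre ← bounds k i =
  off-centre-suc k (suc i) off centre , centre-suc k (suc i) off

-- Comparison with the eigenvalue at `i = 1`.

-- Here `x = -|x| ≤ -|y| ≤ y`.
≤0∧∣∣-maximal⇒≤ : ∀ {x y} → x ≤ℤ 0ℤ → ∣ y ∣ ≤ ∣ x ∣ → x ≤ℤ y
≤0∧∣∣-maximal⇒≤ {y = + n}        x≤0 _ = ℤ.≤-trans x≤0 (+≤+ z≤n)
≤0∧∣∣-maximal⇒≤ {+ zero} {y = -[1+ n ]} x≤0 ()
≤0∧∣∣-maximal⇒≤ {+ suc _} {y = -[1+ n ]} (+≤+ ()) _
≤0∧∣∣-maximal⇒≤ { -[1+ m ]} {y = -[1+ n ]} x≤0 (s≤s n≤m) = -≤- n≤m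

-- The off-centre bound is an equality at `i = 1`, so its right side is `d` times the absolute value
-- there.
∣eigen∣-maximal-at-1 : ∀ k i a b m → suc (a + b) ≡ k + suc i → suc a ≡ b + suc m →
  ∣ eigen k (suc i) (suc a) ∣ ≤ ∣ eigen (a + b) 1 (suc a) ∣
∣eigen∣-maximal-at-1 k i a b m n≡ 1+a≡b+1+m = *-cancelˡ-≤ (suc (a + b))
  (≤-trans (proj₁ (bounds k i) (suc a) b m n≡ refl 1+a≡b+1+m)
           (≤-reflexive (sym (∣eigen₁∣ a b m 1+a≡b+1+m))))

corollary3p11 : (d j : ℕ) → 1 ≤ d → d < 2 * j → j ≤ d →
    ((i : ℕ) → i ≤ d → E (2 * d) d j 1 ≤ℤ E (2 * d) d j i) ×
    ((i : ℕ) → 1 ≤ i → i ≤ d → ∣ E (2 * d) d j i ∣ ≤ ∣ E (2 * d) d j 1 ∣)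
corollary3p11 d (suc a) 1≤d d<2j j≤d
  -- The witnesses are `b = d - j` and `m = 2j - d - 1`.
  with b , refl ← m≤n⇒∃[o]m+o≡n j≤d
  with m , refl ← m≤n⇒∃[o]m+o≡n (≤-pred (subst (b <_) (+-identityʳ (suc a)) (+-cancelˡ-< (suc a) b _ d<2j)))
  = smallest , second
  where
  j = suc (b + m)

  second : (i : ℕ) → 1 ≤ i → i ≤ d → ∣ E (2 * d) d j i ∣ ≤ ∣ E (2 * d) d j 1 ∣
  second (suc i) _ i≤d rewrite E≡eigen d j (suc i) | E≡eigen d j 1 =
    ∣eigen∣-maximal-at-1 (d ∸ suc i) i (b + m) b m (sym (m∸n+n≡m i≤d)) (sym (+-suc b m))

  E₁≤0 : E (2 * d) d j 1 ≤ℤ 0ℤ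
  E₁≤0 rewrite E≡eigen d j 1 = eigen₁-nonpositive (b + m) b m (sym (+-suc b m))

  smallest : (i : ℕ) → i ≤ d → E (2 * d) d j 1 ≤ℤ E (2 * d) d j i
  -- The induction does not cover `i = 0`, but the valency is a square and hence nonnegative.
  smallest zero    _   = ℤ.≤-trans E₁≤0 (subst (0ℤ ≤ℤ_) (sym (E≡eigen d j 0)) (+≤+ z≤n))
  smallest (suc i) i≤d = ≤0∧∣∣-maximal⇒≤ E₁≤0 (second (suc i) (s≤s z≤n) i≤d)
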